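{- Let $t\ge2$ and $v\ge2$ be integers. Then an optimum $(d,t)$-CDA$((d+1)v^t;2t,v)$ exists for every positive integer $d$ with $d+1\le v$.
   Context: Consecutive $t$-way interaction in an $N\times k$ array $A=(a_{ij})$ over a $v$-set $V$: $T=\{(i,x_i),\dots,(i+t-1,x_{i+t-1})\}$, $1\le i\le k-t+1$, $x_r\in V$; $\rho(A,T)=\{r: a_{r,j}=x_j\ \forall (j,x_j)\in T\}$, $\rho(A,\mathcal T)=\bigcup_{T\in\mathcal T}\rho(A,T)$. A $(d,t)$-CDA$(N;k,v)$ is an $N\times k$ array over $V$ in which every $t$ consecutive columns contain every $t$-tuple at least once, and such that for every set $\mathcal T$ of exactly $d$ distinct consecutive $t$-way interactions and every consecutive $t$-way interaction $T$: $\rho(A,T)\subseteq\rho(A,\mathcal T)$ iff $T\in\mathcal T$. It is optimum if $N=(d+1)v^t$. -}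

module Defs where

open import Data.Fin using (Fin; toℕ; fromℕ<)
open import Data.Fin.Properties using (toℕ<n)
open import Data.List using (List; length)
open import Data.List.Membership.Propositional using (_∈_)
open import Data.List.Relation.Unary.Unique.Propositional using (Unique)
open import Data.Nat using (ℕ; _+_; _*_; _^_; _≤_)
open import Data.Nat.Properties using (+-monoʳ-<; <-≤-trans)
open import Data.Product using (_×_; ∃-syntax)
open import Data.Vec using (Vec; lookup)
open import Function.Bundles using (_⇔_)
open import Level using (0ℓ)
open import Relation.Binary.PropositionalEquality using (_≡_)
open import Relation.Unary using (Pred; _⊆_; Satisfiable)

Array : (N k v : ℕ) → Set
Array N k v = Fin N → Fin k → Fin v

-- The interaction {(i,x_i),…,(i+t-1,x_{i+t-1})}, with columns numbered from 0.
-- The bound is irrelevant and the values form a Vec, so that _≡_ on this type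
-- is equality of start column and values, i.e. (for t ≥ 1) equality of the
-- sets of pairs.
record Interaction (t k v : ℕ) : Set where
  constructor interaction
  field
    start  : ℕ
    .fits  : start + t ≤ k
    values : Vec (Fin v) t

open Interaction public

column : ∀ {t k v} → Interaction t k v → Fin t → Fin k
column (interaction i i+t≤k _) j =
  fromℕ< {i + toℕ j} (<-≤-trans (+-monoʳ-< i (toℕ<n j)) i+t≤k)

ρ : ∀ {N t k v} → Array N k v → Interaction t k v → Pred (Fin N) 0ℓ
ρ A T r = ∀ j → A r (column T j) ≡ lookup (values T) j

-- A finite set of interactions is a list; distinctness is required in IsCDA.
ρ⋃ : ∀ {N t k v} → Array N k v → List (Interaction t k v) → Pred (Fin N) 0ℓ
ρ⋃ A 𝒯 r = ∃[ T ] (T ∈ 𝒯 × ρ A T r)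

record IsCDA (d t : ℕ) {N k v : ℕ} (A : Array N k v) : Set where
  field
    covering  : (T : Interaction t k v) → Satisfiable (ρ A T)
    detecting : (𝒯 : List (Interaction t k v)) → Unique 𝒯 → length 𝒯 ≡ d →
                (T : Interaction t k v) → (ρ A T ⊆ ρ⋃ A 𝒯) ⇔ (T ∈ 𝒯)

record IsOptimumCDA (d t : ℕ) {N k v : ℕ} (A : Array N k v) : Set where
  field
    isCDA   : IsCDA d t A
    optimum : N ≡ (d + 1) * v ^ t

{-# OPTIONS --safe #-}
-- Rows are indexed by pairs (z , w) with z < d + 1 and w ∈ V^t, and the row
-- (z , w) is w followed by the translate w + z modulo v.  Any t consecutive
-- columns meet every residue modulo t once, so z and the entries there determine
-- w: every interaction lies in exactly one row for each z.  Two interactions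
-- with starts i < i′ together cover the columns i and i + t, whose difference
-- is z, so they share at most one row.  An interaction has d + 1 rows, hence d
-- others cannot cover it.
module Submission where

open import Data.Nat using (ℕ; _+_; _*_; _^_; _≤_; _<_; _∸_; _≤?_; _<?_; z≤n; NonZero; >-nonZero)
open import Data.Nat.DivMod using (_%_; _mod_; m%n<n; m<n⇒m%n≡m; m%n%n≡m%n; [m+n]%n≡m%n; %-distribˡ-+)
open import Data.Nat.Properties
open import Data.Fin using (Fin; zero; suc; toℕ; fromℕ<; combine; remQuot; quotient; finToFun; funToFin)
open import Data.Fin.Properties using (toℕ-injective; toℕ-fromℕ<; toℕ<n; toℕ-combine; remQuot-combine; combine-remQuot; finToFun-funToFin; pigeonhole)
open import Data.List using (List; length)
open import Data.List.Membership.Propositional using (_∈_)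
open import Data.List.Relation.Unary.Any using (index)
open import Data.List.Relation.Unary.Any.Properties using (lookup-index)
open import Data.Product using (Σ-syntax; _×_; _,_; proj₁; proj₂)
open import Data.Vec using (Vec; lookup; tabulate)
open import Data.Vec.Properties using (tabulate∘lookup; tabulate-cong)
open import Function.Bundles using (mk⇔)
open import Relation.Binary.Definitions using (tri<; tri≈; tri>)
open import Relation.Binary.PropositionalEquality
open import Relation.Nullary using (yes; no; contradiction; recompute)
open import Relation.Unary using (_⊆_)
open import Defs

lookup-ext : ∀ {A : Set} {n} {xs ys : Vec A n} → (∀ i → lookup xs i ≡ lookup ys i) → xs ≡ ys
lookup-ext {xs = xs} {ys} eq = begin
  xs                              ≡⟨ tabulate∘lookup xs ⟨
  tabulate (lookup xs)   ≡⟨ tabulate-cong eq ⟩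
  tabulate (lookup ys)   ≡⟨ tabulate∘lookup ys ⟩
  ys                              ∎
  where open ≡-Reasoning

-- Translation modulo `v`.

module _ {v : ℕ} .{{_ : NonZero v}} where

  open ≡-Reasoning

  +-congʳ-% : ∀ o {m n} → m % v ≡ n % v → (o + m) % v ≡ (o + n) % v
  +-congʳ-% o {m} {n} m≡n = begin
    (o + m) % v          ≡⟨ %-distribˡ-+ o m v ⟩
    (o % v + m % v) % v  ≡⟨ cong (λ k → (o % v + k) % v) m≡n ⟩
    (o % v + n % v) % v  ≡⟨ %-distribˡ-+ o n v ⟨
    (o + n) % v          ∎

  [n∸m]+[m+o]%n≡o%n : ∀ {m} o → m ≤ v → ((v ∸ m) + (m + o)) % v ≡ o % v
  [n∸m]+[m+o]%n≡o%n {m} o m≤v = begin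
    ((v ∸ m) + (m + o)) % v  ≡⟨ cong (_% v) (+-assoc (v ∸ m) m o) ⟨
    (v ∸ m + m + o) % v      ≡⟨ cong (λ k → (k + o) % v) (m∸n+n≡m m≤v) ⟩
    (v + o) % v              ≡⟨ cong (_% v) (+-comm v o) ⟩
    (o + v) % v              ≡⟨ [m+n]%n≡m%n o v ⟩
    o % v                    ∎

  -- Adding `v ∸ o` undoes adding `o` modulo `v`; the bound `o ≤ v` keeps the truncated subtraction
  -- exact.
  +-cancelˡ-% : ∀ {o m n} → o ≤ v → (o + m) % v ≡ (o + n) % v → m % v ≡ n % v
  +-cancelˡ-% {o} {m} {n} o≤v eq = begin
    m % v                    ≡⟨ [n∸m]+[m+o]%n≡o%n m o≤v ⟨
    ((v ∸ o) + (o + m)) % v  ≡⟨ +-congʳ-% (v ∸ o) eq ⟩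
    ((v ∸ o) + (o + n)) % v  ≡⟨ [n∸m]+[m+o]%n≡o%n n o≤v ⟩
    n % v                    ∎

  infixl 6 _⊕_ _⊖_

  _⊕_ _⊖_ : Fin v → ℕ → Fin v
  x ⊕ m = (toℕ x + m) mod v
  x ⊖ m = x ⊕ (v ∸ m)

  toℕ-⊕ : ∀ x m → toℕ (x ⊕ m) ≡ (toℕ x + m) % v
  toℕ-⊕ x m = toℕ-fromℕ< (m%n<n (toℕ x + m) v)

  ⊕-cancelˡ : ∀ x {m n} → m < v → n < v → x ⊕ m ≡ x ⊕ n → m ≡ n
  ⊕-cancelˡ x {m} {n} m<v n<v eq = begin
    m      ≡⟨ m<n⇒m%n≡m m<v ⟨
    m % v  ≡⟨ +-cancelˡ-% (<⇒≤ (toℕ<n x)) (trans (sym (toℕ-⊕ x m)) (trans (cong toℕ eq) (toℕ-⊕ x n))) ⟩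
    n % v  ≡⟨ m<n⇒m%n≡m n<v ⟩
    n      ∎

  ⊖-⊕ : ∀ x {m} → m ≤ v → x ⊖ m ⊕ m ≡ x
  ⊖-⊕ x {m} m≤v = toℕ-injective (begin
    toℕ (x ⊖ m ⊕ m)                  ≡⟨ toℕ-⊕ (x ⊖ m) m ⟩
    (toℕ (x ⊖ m) + m) % v            ≡⟨ cong (_% v) (+-comm (toℕ (x ⊖ m)) m) ⟩
    (m + toℕ (x ⊖ m)) % v            ≡⟨ +-congʳ-% m (trans (cong (_% v) (toℕ-⊕ x (v ∸ m))) (m%n%n≡m%n _ v)) ⟩
    (m + (toℕ x + (v ∸ m))) % v      ≡⟨ cong (_% v) rearrange ⟩
    ((v ∸ m) + (m + toℕ x)) % v      ≡⟨ [n∸m]+[m+o]%n≡o%n (toℕ x) m≤v ⟩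
    toℕ x % v                        ≡⟨ m<n⇒m%n≡m (toℕ<n x) ⟩
    toℕ x                            ∎)
    where
    rearrange : m + (toℕ x + (v ∸ m)) ≡ (v ∸ m) + (m + toℕ x)
    rearrange = trans (sym (+-assoc m (toℕ x) (v ∸ m))) (+-comm (m + toℕ x) (v ∸ m))

-- Columns covered by an interaction.

toℕ-column : ∀ {t k v} (T : Interaction t k v) j → toℕ (column T j) ≡ start T + toℕ j
toℕ-column (interaction i i+t≤k _) j = toℕ-fromℕ< (<-≤-trans (+-monoʳ-< i (toℕ<n j)) i+t≤k)

start≤ : ∀ {t v} (T : Interaction t (2 * t) v) → start T ≤ t
-- The field `fits` is irrelevant, so the bound derived from it is recovered by deciding `i ≤ t`.
-- The `subst` removes the `+ 0` left when `2 * t` unfolds.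
start≤ {t} (interaction i i+t≤2t _) = recompute (i ≤? t)
  (+-cancelʳ-≤ t i t (subst (λ s → i + t ≤ t + s) (+-identityʳ t) i+t≤2t))

-- Column `c` is `column T j` for the offset `j` of `c` from `start T`, and both rows carry the
-- prescribed value there.
ρ-agree : ∀ {N t k v} (A : Array N k v) (T : Interaction t k v) {r r′} → ρ A T r → ρ A T r′ →
          ∀ c → start T ≤ toℕ c → toℕ c < start T + t → A r c ≡ A r′ c
ρ-agree {t = t} A T {r} {r′} r∈ r′∈ c i≤c c<i+t =
  subst (λ c′ → A r c′ ≡ A r′ c′) col≡c (trans (r∈ j) (sym (r′∈ j)))
  where
  open ≡-Reasoning
  c∸i<t : toℕ c ∸ start T < t
  c∸i<t = subst (toℕ c ∸ start T <_) (m+n∸m≡n (start T) t) (∸-monoˡ-< c<i+t i≤c)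
  j = fromℕ< c∸i<t
  col≡c : column T j ≡ c
  col≡c = toℕ-injective (begin
    toℕ (column T j)               ≡⟨ toℕ-column T j ⟩
    start T + toℕ j                ≡⟨ cong (start T +_) (toℕ-fromℕ< c∸i<t) ⟩
    start T + (toℕ c ∸ start T)    ≡⟨ m+[n∸m]≡n i≤c ⟩
    toℕ c                          ∎)

-- The array of translates.

module Translates (t v n : ℕ) .{{_ : NonZero v}} (n≤v : n ≤ v) where

  Rows : ℕ
  Rows = n * v ^ t

  shift : Fin Rows → Fin n
  shift = quotient (v ^ t)

  base : Fin Rows → Fin t → Fin v
  base r = finToFun (proj₂ (remQuot {n} (v ^ t) r))

  row : Fin n → (Fin t → Fin v) → Fin Rows
  row z w = combine z (funToFin w)

  shift-row : ∀ z w → shift (row z w) ≡ z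
  shift-row z w = cong proj₁ (remQuot-combine z (funToFin w))

  base-row : ∀ z w m → base (row z w) m ≡ w m
  base-row z w m = trans (cong (λ p → finToFun (proj₂ p) m) (remQuot-combine z (funToFin w)))
                         (finToFun-funToFin w m)

  -- The `2 * t` columns are split by `combine`: the first component picks the word or its
  -- translate, the second a position in the word.
  half : Fin 2 → Fin v → Fin n → Fin v
  half zero    x z = x
  half (suc _) x z = x ⊕ toℕ z

  translates : Array Rows (2 * t) v
  translates r c with b , m ← remQuot {2} t c = half b (base r m) (shift r)

  translates-combine : ∀ r b m → translates r (combine b m) ≡ half b (base r m) (shift r)
  translates-combine r b m = cong (λ (b′ , m′) → half b′ (base r m′) (shift r)) (remQuot-combine {2} b m)

  shift<v : ∀ (z : Fin n) → toℕ z < v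
  shift<v z = <-≤-trans (toℕ<n z) n≤v

  toℕ-combine-0 : ∀ (m : Fin t) → toℕ (combine {2} zero m) ≡ toℕ m
  toℕ-combine-0 m = trans (toℕ-combine {2} zero m) (cong (_+ toℕ m) (*-zeroʳ t))

  toℕ-combine-1 : ∀ (m : Fin t) → toℕ (combine {2} (suc zero) m) ≡ t + toℕ m
  toℕ-combine-1 m = trans (toℕ-combine {2} (suc zero) m) (cong (_+ toℕ m) (*-identityʳ t))

  -- The unique w for which the row (z , w) realises T.
  solution : Interaction t (2 * t) v → Fin n → Fin t → Fin v
  solution T z m with toℕ m <? start T
  ... | yes m<i = lookup (values T) (fromℕ< {t + toℕ m ∸ start T} bound) ⊖ toℕ z
    where
    bound : t + toℕ m ∸ start T < t
    bound = subst (t + toℕ m ∸ start T <_) (m+n∸n≡m t (start T))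
              (∸-monoˡ-< (+-monoʳ-< t m<i) (≤-trans (start≤ T) (m≤m+n t (toℕ m))))
  ... | no _    = lookup (values T) (fromℕ< {toℕ m ∸ start T} (≤-<-trans (m∸n≤m (toℕ m) (start T)) (toℕ<n m)))

  -- The bound is irrelevant, so this applies to whichever bound `solution` supplies.
  fromℕ<-offset : ∀ {c} i (j : Fin t) → c ≡ i + toℕ j → .(lt : c ∸ i < t) → fromℕ< lt ≡ j
  fromℕ<-offset i j refl lt = toℕ-injective (trans (toℕ-fromℕ< lt) (m+n∸m≡n i (toℕ j)))

  -- Column `m` lies in the window of `T`, hence not to the left of its start, and the entry is read
  -- off directly.
  solution-0 : ∀ T z m j → toℕ m ≡ start T + toℕ j → solution T z m ≡ lookup (values T) j
  solution-0 T z m j eq with toℕ m <? start T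
  ... | yes m<i = contradiction (subst (start T ≤_) (sym eq) (m≤m+n (start T) (toℕ j))) (<⇒≱ m<i)
  ... | no _    = cong (lookup (values T)) (fromℕ<-offset (start T) j eq _)

  -- If `m` were at least `start T`, then `t + m` would lie beyond the window. So the first branch
  -- applies: the prescribed value is the translated entry, and the shift is subtracted from it.
  solution-1 : ∀ T z m j → t + toℕ m ≡ start T + toℕ j → solution T z m ≡ lookup (values T) j ⊖ toℕ z
  solution-1 T z m j eq with toℕ m <? start T
  ... | yes _   = cong (λ l → lookup (values T) l ⊖ toℕ z) (fromℕ<-offset (start T) j eq _)
  ... | no m≮i = contradiction eq (≢-sym (<⇒≢ (<-≤-trans
                   (+-monoʳ-< (start T) (toℕ<n j))
                   (subst (_≤ t + toℕ m) (+-comm t (start T)) (+-monoʳ-≤ t (≮⇒≥ m≮i))))))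

  ρ-row-solution : ∀ T z → ρ translates T (row z (solution T z))
  -- The split of the column is passed as an arbitrary pair with its equation, so that the two
  -- halves can be treated by matching.
  ρ-row-solution T z j = go (remQuot {2} t (column T j)) (combine-remQuot {2} t (column T j))
    where
    open ≡-Reasoning
    r = row z (solution T z)
    go : ∀ ((b , m) : Fin 2 × Fin t) → combine b m ≡ column T j →
         translates r (column T j) ≡ lookup (values T) j
    go (zero , m) eq = begin
      translates r (column T j)         ≡⟨ cong (translates r) eq ⟨
      translates r (combine {2} zero m) ≡⟨ translates-combine r zero m ⟩
      base r m                          ≡⟨ base-row z (solution T z) m ⟩
      solution T z m                    ≡⟨ solution-0 T z m j position ⟩
      lookup (values T) j               ∎
      where
      position : toℕ m ≡ start T + toℕ j
      position = trans (sym (toℕ-combine-0 m)) (trans (cong toℕ eq) (toℕ-column T j))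
    go (suc zero , m) eq = begin
      translates r (column T j)               ≡⟨ cong (translates r) eq ⟨
      translates r (combine {2} (suc zero) m) ≡⟨ translates-combine r (suc zero) m ⟩
      base r m ⊕ toℕ (shift r)                ≡⟨ cong₂ (λ x s → x ⊕ toℕ s) (base-row z (solution T z) m) (shift-row z (solution T z)) ⟩
      solution T z m ⊕ toℕ z                  ≡⟨ cong (_⊕ toℕ z) (solution-1 T z m j position) ⟩
      lookup (values T) j ⊖ toℕ z ⊕ toℕ z     ≡⟨ ⊖-⊕ (lookup (values T) j) (<⇒≤ (shift<v z)) ⟩
      lookup (values T) j                     ∎
      where
      position : t + toℕ m ≡ start T + toℕ j
      position = trans (sym (toℕ-combine-1 m)) (trans (cong toℕ eq) (toℕ-column T j))

  -- Column `start T` lies in the window of `T`. Column `t + start T` lies in that of `T′`, because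
  -- `start T′ ≤ t ≤ t + start T < t + start T′`. Rows agreeing in both have the same difference
  -- between these entries, which is the shift.
  shared-shift : ∀ {r r′} T T′ → start T < start T′ →
                 ρ translates T r → ρ translates T r′ → ρ translates T′ r → ρ translates T′ r′ →
                 shift r ≡ shift r′
  shared-shift {r} {r′} T T′ i<i′ Tr Tr′ T′r T′r′ =
    toℕ-injective (⊕-cancelˡ (base r m) (shift<v _) (shift<v _) (begin
      base r m ⊕ toℕ (shift r)                 ≡⟨ translates-combine r (suc zero) m ⟨
      translates r (combine {2} (suc zero) m)  ≡⟨ ρ-agree translates T′ T′r T′r′ (combine {2} (suc zero) m)
                                                    (subst (start T′ ≤_) (sym col₁) (≤-trans (start≤ T′) (m≤m+n t (start T))))
                                                    (subst₂ _<_ (sym col₁) (+-comm t (start T′)) (+-monoʳ-< t i<i′)) ⟩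
      translates r′ (combine {2} (suc zero) m) ≡⟨ translates-combine r′ (suc zero) m ⟩
      base r′ m ⊕ toℕ (shift r′)               ≡⟨ cong (_⊕ toℕ (shift r′)) same-base ⟨
      base r m ⊕ toℕ (shift r′)                ∎))
    where
    open ≡-Reasoning
    -- As `start T′` is at most `t`, the earlier start is a column of the first half.
    i<t : start T < t
    i<t = <-≤-trans i<i′ (start≤ T′)
    m : Fin t
    m = fromℕ< i<t
    col₀ : toℕ (combine {2} zero m) ≡ start T
    col₀ = trans (toℕ-combine-0 m) (toℕ-fromℕ< i<t)
    col₁ : toℕ (combine {2} (suc zero) m) ≡ t + start T
    col₁ = trans (toℕ-combine-1 m) (cong (t +_) (toℕ-fromℕ< i<t))
    same-base : base r m ≡ base r′ m
    same-base = begin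
      base r m                            ≡⟨ translates-combine r zero m ⟨
      translates r (combine {2} zero m)   ≡⟨ ρ-agree translates T Tr Tr′ (combine {2} zero m)
                                               (≤-reflexive (sym col₀))
                                               (subst (_< start T + t) (sym col₀) (m<m+n (start T) (≤-<-trans z≤n i<t))) ⟩
      translates r′ (combine {2} zero m)  ≡⟨ translates-combine r′ zero m ⟩
      base r′ m                           ∎

  -- Distinct starts, in either order, would force equal shifts. With equal starts, one common row
  -- already determines the values.
  shared-rows⇒≡ : ∀ {r r′} T T′ → shift r ≢ shift r′ →
                  ρ translates T r → ρ translates T r′ → ρ translates T′ r → ρ translates T′ r′ →
                  T ≡ T′
  shared-rows⇒≡ T@(interaction i fits _) T′@(interaction i′ _ _) r≢r′ Tr Tr′ T′r T′r′ with <-cmp i i′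
  ... | tri< i<i′ _ _ = contradiction (shared-shift T T′ i<i′ Tr Tr′ T′r T′r′) r≢r′
  ... | tri> _ _ i′<i = contradiction (shared-shift T′ T i′<i T′r T′r′ Tr Tr′) r≢r′
  ... | tri≈ _ refl _ = cong (λ xs → interaction i fits xs) (lookup-ext (λ j → trans (sym (Tr j)) (T′r j)))

  -- `T` has one row for each of the `n` shifts. With fewer than `n` members, some member of `𝒯`
  -- contains two of these rows, and so equals `T`.
  covered⇒∈ : ∀ (𝒯 : List (Interaction t (2 * t) v)) → length 𝒯 < n →
              ∀ T → ρ translates T ⊆ ρ⋃ translates 𝒯 → T ∈ 𝒯
  covered⇒∈ 𝒯 ∣𝒯∣<n T T⊆𝒯 = subst (_∈ 𝒯) (sym T≡T₁) (proj₁ (proj₂ (cover z₁)))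
    where
    r : Fin n → Fin Rows
    r z = row z (solution T z)
    cover : ∀ z → ρ⋃ translates 𝒯 (r z)
    cover z = T⊆𝒯 (ρ-row-solution T z)
    -- Positions in the list serve as pigeonholes; equal positions give equal interactions by
    -- `lookup-index`.
    choice : Fin n → Fin (length 𝒯)
    choice z = index (proj₁ (proj₂ (cover z)))
    collision = pigeonhole ∣𝒯∣<n choice
    z₁ = proj₁ collision
    z₂ = proj₁ (proj₂ collision)
    z₁<z₂ = proj₁ (proj₂ (proj₂ collision))
    T₂≡T₁ : proj₁ (cover z₂) ≡ proj₁ (cover z₁)
    T₂≡T₁ = trans (lookup-index (proj₁ (proj₂ (cover z₂))))
              (trans (cong (Data.List.lookup 𝒯) (sym (proj₂ (proj₂ (proj₂ collision)))))
                (sym (lookup-index (proj₁ (proj₂ (cover z₁))))))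
    shifts-differ : shift (r z₁) ≢ shift (r z₂)
    shifts-differ eq = <⇒≢ z₁<z₂ (cong toℕ (trans (sym (shift-row z₁ _)) (trans eq (shift-row z₂ _))))
    T≡T₁ : T ≡ proj₁ (cover z₁)
    T≡T₁ = shared-rows⇒≡ T (proj₁ (cover z₁)) shifts-differ
             (ρ-row-solution T z₁) (ρ-row-solution T z₂)
             (proj₂ (proj₂ (cover z₁)))
             (subst (λ T′ → ρ translates T′ (r z₂)) T₂≡T₁ (proj₂ (proj₂ (cover z₂))))

mainTheorem8 : (t v : ℕ) → 2 ≤ t → 2 ≤ v →
    (d : ℕ) → 1 ≤ d → d + 1 ≤ v →
    Σ[ A ∈ Array ((d + 1) * v ^ t) (2 * t) v ] IsOptimumCDA d t A
mainTheorem8 t v _ 2≤v d _ d+1≤v = translates , record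
  { isCDA = record
    -- Any shift would do here; `z₀` is the largest one, `d`.
    { covering  = λ T → row z₀ (solution T z₀) , ρ-row-solution T z₀
    ; detecting = λ 𝒯 _ ∣𝒯∣≡d T → mk⇔
        (covered⇒∈ 𝒯 (subst (_< d + 1) (sym ∣𝒯∣≡d) d<d+1) T)
        (λ T∈𝒯 Tr → T , T∈𝒯 , Tr)
    }
  ; optimum = refl
  }
  where
  instance
    v≢0 : NonZero v
    v≢0 = >-nonZero (<⇒≤ 2≤v)
  open Translates t v (d + 1) d+1≤v
  d<d+1 : d < d + 1
  d<d+1 = m<m+n d ≤-refl
  z₀ : Fin (d + 1)
  z₀ = fromℕ< d<d+1
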